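{- If $G$ is a bipartite graph with no induced path on $6$ vertices, then $\operatorname{reg}(G)=\operatorname{im}(G)$.
   Context: $\operatorname{reg}(G)=\max\{j\ge0:\widetilde H_{j-1}(\operatorname{Ind}(G[S]);\Bbbk)\neq0\text{ for some }S\subseteq V(G)\}$ over a field $\Bbbk$ ($\operatorname{Ind}$ = independence complex). $\operatorname{im}(G)$ is the induced matching number: maximum size of a set of edges that are pairwise vertex-disjoint and such that no edge of $G$ joins two of them. -}

module Defs where

open import Level using (_⊔_)
open import Algebra.Bundles using (CommutativeRing)
open import Algebra.Apartness.Bundles using (HeytingCommutativeRing; HeytingField)
import Algebra.Properties.Monoid.Sum as Sum
import Algebra.Properties.Semiring.Exp as Exp
open import Data.Bool.Base using (if_then_else_)
open import Data.Fin.Base using (Fin; toℕ)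
open import Data.Fin.Properties using (_<?_)
open import Data.Fin.Subset using (Subset; _∈_; _⊆_; _∪_; _∩_; ∁; ⁅_⁆; ∣_∣)
  renaming (⊥ to ∅)
open import Data.Fin.Subset.Properties using (_∈?_; ⊥⊆; ∉⊥; ⊆-trans)
open import Data.Nat.Base using (ℕ; suc; _≤_)
open import Data.Nat.Properties using (≤-antisym; 1+n≢n) renaming (_≟_ to _≟ℕ_)
open import Data.Product.Base using (Σ-syntax; ∃-syntax; _×_; _,_; proj₁; proj₂)
open import Data.Sum.Base using (_⊎_; inj₁; inj₂; swap)
open import Data.Vec.Base using (tabulate)
open import Function.Bundles using (_⇔_)
open import Function.Definitions using (Injective)
open import Relation.Binary.Definitions using (Decidable; Symmetric; Irreflexive)
open import Relation.Binary.PropositionalEquality using (_≡_; _≢_; refl)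
open import Relation.Nullary using (¬_; does; contradiction)
open import Relation.Nullary.Decidable using (_⊎-dec_)

record Graph (n : ℕ) : Set₁ where
  field
    Adj        : Fin n → Fin n → Set
    adj?       : Decidable Adj
    adj-sym    : Symmetric Adj
    adj-irrefl : Irreflexive _≡_ Adj

path : (m : ℕ) → Graph m
path m = record
  { Adj        = λ i j → suc (toℕ i) ≡ toℕ j ⊎ suc (toℕ j) ≡ toℕ i
  ; adj?       = λ i j → (suc (toℕ i) ≟ℕ toℕ j) ⊎-dec (suc (toℕ j) ≟ℕ toℕ i)
  ; adj-sym    = swap
  ; adj-irrefl = λ { refl (inj₁ e) → 1+n≢n e ; refl (inj₂ e) → 1+n≢n e }
  }

InducedIn : ∀ {m n} → Graph m → Graph n → Set
InducedIn {m} {n} H G =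
  Σ[ f ∈ (Fin m → Fin n) ]
    Injective _≡_ _≡_ f
    × (∀ i j → Graph.Adj H i j ⇔ Graph.Adj G (f i) (f j))

module _ {n : ℕ} (G : Graph n) where
  open Graph G

  Independent : Subset n → Set
  Independent F = ∀ u v → u ∈ F → v ∈ F → ¬ Adj u v

  Bipartite : Set
  Bipartite = ∃[ A ] (Independent A × Independent (∁ A))

  -- An induced matching of size m, its edges e i listed without repetition:
  -- distinct indices give disjoint edges, hence distinct ones.
  IsInducedMatching : (m : ℕ) → (Fin m → Fin n × Fin n) → Set
  IsInducedMatching m e =
    (∀ i → Adj (proj₁ (e i)) (proj₂ (e i)))
    × (∀ i j → i ≢ j → ∀ u v → u isEndOf e i → v isEndOf e j →
         u ≢ v × ¬ Adj u v)
    where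
    _isEndOf_ : Fin n → Fin n × Fin n → Set
    u isEndOf (a , b) = u ≡ a ⊎ u ≡ b

record SimplicialComplex (n : ℕ) : Set₁ where
  field
    Face        : Subset n → Set
    ∅-face      : Face ∅
    down-closed : ∀ {E F} → E ⊆ F → Face F → Face E

-- Ind (G[S]): a set of vertices of the induced subgraph G[S] is independent
-- in G[S] exactly when it is independent in G.
Ind : ∀ {n} → Graph n → Subset n → SimplicialComplex n
Ind G S = record
  { Face        = λ F → F ⊆ S × Independent G F
  ; ∅-face      = ⊥⊆ , λ u v u∈∅ → contradiction u∈∅ ∉⊥
  ; down-closed = λ { E⊆F (F⊆S , ind) →
      ⊆-trans E⊆F F⊆S , λ u v u∈E v∈E → ind u v (E⊆F u∈E) (E⊆F v∈E) }
  }

-- Augmented oriented simplicial chains, with the vertices ordered as in Fin n.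
-- Chains are graded by the number of vertices: a j-vertex face has dimension
-- j - 1, and the empty face spans degree -1.
module Homology {c ℓ} (R : CommutativeRing c ℓ) where
  open CommutativeRing R
  open Sum +-monoid using (sum)
  open Exp semiring using (_^_)

  IsChain : ∀ {n} → SimplicialComplex n → ℕ → (Subset n → Carrier) → Set ℓ
  IsChain X j z =
    ∀ F → ¬ (SimplicialComplex.Face X F × ∣ F ∣ ≡ j) → z F ≈ 0#

  -- The number of elements of F below x, which is the position (from 0) of x
  -- in the increasing listing of F ∪ {x}.
  position : ∀ {n} → Fin n → Subset n → ℕ
  position x F = ∣ F ∩ tabulate (λ y → does (y <? x)) ∣

  -- ∂ [v₀,…,vₖ] = Σᵢ (-1)ⁱ [v₀,…,v̂ᵢ,…,vₖ], read off at the coefficient of F.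
  ∂ : ∀ {n} → (Subset n → Carrier) → Subset n → Carrier
  ∂ z F = sum λ x →
    if does (x ∈? F)
      then 0#
      else (- 1#) ^ position x F * z (F ∪ ⁅ x ⁆)

  IsCycle : ∀ {n} → SimplicialComplex n → ℕ → (Subset n → Carrier) → Set ℓ
  IsCycle X j z = IsChain X j z × (∀ F → ∂ z F ≈ 0#)

  IsBoundary : ∀ {n} → SimplicialComplex n → ℕ → (Subset n → Carrier) →
               Set (c ⊔ ℓ)
  IsBoundary X j z = ∃[ w ] (IsChain X (suc j) w × (∀ F → ∂ w F ≈ z F))

  -- The reduced homology of X in dimension j - 1 is nonzero.
  NonzeroReducedHomology : ∀ {n} → SimplicialComplex n → ℕ → Set (c ⊔ ℓ)
  NonzeroReducedHomology X j = ∃[ z ] (IsCycle X j z × ¬ IsBoundary X j z)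

IsMax : ∀ {a} → (ℕ → Set a) → ℕ → Set a
IsMax P m = P m × (∀ k → P k → k ≤ m)

IsMax-unique : ∀ {a} {P : ℕ → Set a} {m m′} → IsMax P m → IsMax P m′ → m ≡ m′
IsMax-unique (p , ub) (p′ , ub′) = ≤-antisym (ub′ _ p) (ub _ p′)

-- Classically, a Heyting field is the same thing as a field.
IsReg : ∀ {c ℓ₁ ℓ₂ n} → HeytingField c ℓ₁ ℓ₂ → Graph n → ℕ → Set (c ⊔ ℓ₁)
IsReg {n = n} K G = IsMax λ j → Σ[ S ∈ Subset n ] NonzeroReducedHomology (Ind G S) j
  where
  open Homology (HeytingCommutativeRing.commutativeRing
                  (HeytingField.heytingCommutativeRing K))

IsIm : ∀ {n} → Graph n → ℕ → Set
IsIm G = IsMax λ m → ∃[ e ] IsInducedMatching G m e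

{-# OPTIONS --safe #-}

-- Upper bound. In an induced subgraph G[S] choose v of maximal degree, and let
-- M be an induced matching of G[S] - N[v]. Since G has no induced P₆, the
-- neighbourhoods in M of the neighbours of v form a chain. Hence either some
-- neighbour u of v has no neighbour in M, so that M + vu is an induced matching
-- of G[S], or some vertex a of M is adjacent to all neighbours of v and, having
-- its partner in M as a further neighbour, has larger degree than v. So the
-- induced matching number of G[S] - N[v] is smaller than that of G[S], and the
-- exact sequence relating the deletion and the link of v in Ind(G[S]) bounds the
-- regularity by induction. If v is isolated, Ind(G[S]) is a cone instead.
--
-- Lower bound. On the vertices of an induced matching of size m, the
-- independence complex is the boundary of a cross-polytope, whose fundamental
-- cycle is not a boundary: its coefficient at the face of first ends is ±1, and
-- that face lies in no larger one.
module Submission where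

open import Defs
open import Algebra.Apartness.Bundles using (HeytingCommutativeRing; HeytingField)
open import Algebra.Bundles using (CommutativeRing)
import Algebra.Properties.AbelianGroup as AbelianGroupProperties
import Algebra.Properties.CommutativeSemigroup as CommutativeSemigroupProperties
import Algebra.Properties.Monoid.Sum as Sum
import Algebra.Properties.Ring as RingProperties
import Algebra.Properties.Semiring.Exp as Exp
open import Data.Bool.Base using (Bool; true; false; if_then_else_; not)
open import Data.Bool.Properties using (¬-not; not-¬)
open import Data.Fin.Base using (Fin; zero; suc)
open import Data.Fin.Patterns
open import Data.Fin.Properties using (_≟_; 0≢1+n; all?; any?; injective⇒≤)
open import Data.Fin.Subset
open import Data.Fin.Subset.Induction using (⊂-wellFounded; Acc; acc)
open import Data.Fin.Subset.Properties
open import Data.List.Base using (allFin; filter)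
open import Data.List.Extrema.Nat using (argmax; argmax-all; f[xs]≤f[argmax])
open import Data.List.Membership.Propositional.Properties using (∈-allFin; ∈-filter⁺)
import Data.List.Relation.Unary.All as All
open import Data.List.Relation.Unary.All.Properties using (all-filter)
open import Data.Nat.Base using (ℕ; zero; suc; _≤_)
open import Data.Nat.Properties
  using (_≤?_; <⇒≱; m≤n⇒m<n∨m≡n; ≤-pred; suc-injective)
open import Data.Product.Base
  using (Σ-syntax; ∃; ∃-syntax; _×_; _,_; proj₁; proj₂; map)
open import Data.Sum.Base as ⊎ using (_⊎_; inj₁; inj₂)
open import Data.Vec.Base
  using (Vec; []; _∷_; here; there; lookup; tabulate; _[_]≔_)
open import Data.Vec.Properties
  using ([]=⇒lookup; []≔-minimal; []≔-updates; lookup⇒[]=; lookup∘tabulate)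
open import Function.Base using (_∘_; id)
open import Function.Bundles using (_⇔_; mk⇔; Equivalence)
open import Level using (_⊔_)
open import Relation.Binary.PropositionalEquality as ≡ using (_≡_; _≢_; cong; subst)
open import Relation.Nullary using (¬_; Dec; yes; no; does; contradiction)
open import Relation.Nullary.Decidable
  using (True; False; ¬?; _×-dec_; _⊎-dec_; _→-dec_; decidable-stable; dec-false; dec-true;
         from-yes; map′; toWitness; toWitnessFalse)
open import Relation.Unary using (Decidable)

-- Finite sets

∣p∩⊥∣≡0 : ∀ {n} (F : Subset n) → ∣ F ∩ tabulate (λ _ → false) ∣ ≡ 0
∣p∩⊥∣≡0 []            = ≡.refl
∣p∩⊥∣≡0 (inside ∷ F)  = ∣p∩⊥∣≡0 F
∣p∩⊥∣≡0 (outside ∷ F) = ∣p∩⊥∣≡0 F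

∈-insert⁻ : ∀ {n} (F : Subset n) v {x} → x ∈ F [ v ]≔ inside → x ≡ v ⊎ x ∈ F
∈-insert⁻ (s ∷ F) zero    here       = inj₁ ≡.refl
∈-insert⁻ (s ∷ F) zero    (there x∈) = inj₂ (there x∈)
∈-insert⁻ (s ∷ F) (suc v) here       = inj₂ here
∈-insert⁻ (s ∷ F) (suc v) (there x∈) = ⊎.map (cong suc) there (∈-insert⁻ F v x∈)

∈-insert⁺ : ∀ {n} (F : Subset n) v {x} → x ∈ F → x ∈ F [ v ]≔ inside
∈-insert⁺ F v {x} x∈F with x ≟ v
... | yes ≡.refl = []≔-updates F v
... | no x≢v     = []≔-minimal F x v x≢v x∈F

∣insert∣ : ∀ {n} (F : Subset n) v → v ∉ F → ∣ F [ v ]≔ inside ∣ ≡ suc ∣ F ∣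
∣insert∣ (inside  ∷ F) zero    v∉F = contradiction here v∉F
∣insert∣ (outside ∷ F) zero    v∉F = ≡.refl
∣insert∣ (inside  ∷ F) (suc v) v∉F = cong suc (∣insert∣ F v (v∉F ∘ there))
∣insert∣ (outside ∷ F) (suc v) v∉F = ∣insert∣ F v (v∉F ∘ there)

∣remove∣ : ∀ {n} (F : Subset n) v → v ∈ F → ∣ F ∣ ≡ suc ∣ F [ v ]≔ outside ∣
∣remove∣ (inside  ∷ F) zero    v∈F        = ≡.refl
∣remove∣ (inside  ∷ F) (suc v) (there v∈) = cong suc (∣remove∣ F v v∈)
∣remove∣ (outside ∷ F) (suc v) (there v∈) = ∣remove∣ F v v∈

module _ {n} {P : Fin n → Set} (P? : Decidable P) where

  select : Subset n
  select = tabulate (does ∘ P?)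

  ∈-select⁺ : ∀ {x} → P x → x ∈ select
  ∈-select⁺ {x} p =
    lookup⇒[]= x select (≡.trans (lookup∘tabulate (does ∘ P?) x) (dec-true (P? x) p))

  ∈-select⁻ : ∀ {x} → x ∈ select → P x
  ∈-select⁻ {x} x∈ = decidable-stable (P? x) λ ¬p →
    not-¬ (≡.trans (≡.sym (lookup∘tabulate (does ∘ P?) x)) ([]=⇒lookup x∈)) (dec-false (P? x) ¬p)

maximiser : ∀ {n} (f : Fin n → ℕ) (S : Subset n) → Nonempty S →
            ∃[ v ] (v ∈ S × (∀ x → x ∈ S → f x ≤ f v))
maximiser {n} f S (s , s∈S) =
  argmax f s xs , argmax-all f s∈S (all-filter (_∈? S) (allFin n)) ,
  λ x x∈S → All.lookup (f[xs]≤f[argmax] s xs) (∈-filter⁺ (_∈? S) (∈-allFin x) x∈S)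
  where xs = filter (_∈? S) (allFin n)

-- Downward search from the bound, which decidability of `P` makes constructive.
maximum : ∀ {a} {P : ℕ → Set a} → (∀ k → Dec (P k)) → P 0 → ∀ n → (∀ k → P k → k ≤ n) →
          ∃[ m ] IsMax P m
maximum P? p0 zero    ub = 0 , p0 , ub
maximum P? p0 (suc n) ub with P? (suc n)
... | yes p = suc n , p , ub
... | no ¬p = maximum P? p0 n λ k pk → ⊎.[ ≤-pred , (λ { ≡.refl → contradiction pk ¬p }) ]′
                                         (m≤n⇒m<n∨m≡n (ub k pk))

-- Chains on a simplex

module Chains {c ℓ} (R : CommutativeRing c ℓ) where
  open CommutativeRing R hiding (zero)
  open Homology R
  open Exp semiring using (_^_)
  open Sum +-monoid using (sum; sum-cong-≋)
  open AbelianGroupProperties +-abelianGroup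
    using (ε⁻¹≈ε; ⁻¹-involutive; ⁻¹-∙-comm; inverseˡ-unique; xyx⁻¹≈y)
  open CommutativeSemigroupProperties +-commutativeSemigroup using (interchange)
  open RingProperties ring using (-‿distribˡ-*; x+x≈x⇒x≈0)
  open import Relation.Binary.Reasoning.Setoid setoid

  Chain : ℕ → Set c
  Chain n = Subset n → Carrier

  infix 4 _≐_
  _≐_ : ∀ {n} → Chain n → Chain n → Set ℓ
  c ≐ e = ∀ F → c F ≈ e F

  infixl 6 _⊕_
  _⊕_ : ∀ {n} → Chain n → Chain n → Chain n
  (c ⊕ e) F = c F + e F

  ⊖_ : ∀ {n} → Chain n → Chain n
  (⊖ c) F = - c F

  𝟘 : ∀ {n} → Chain n
  𝟘 _ = 0#

  record Linear {m n} (T : Chain m → Chain n) : Set (c ⊔ ℓ) where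
    field
      T-cong : ∀ {c e} → c ≐ e → T c ≐ T e
      T-⊕    : ∀ c e → T (c ⊕ e) ≐ T c ⊕ T e

    T-𝟘 : T 𝟘 ≐ 𝟘
    T-𝟘 F = x+x≈x⇒x≈0 _ (sym (trans (T-cong (λ _ → sym (+-identityʳ 0#)) F) (T-⊕ 𝟘 𝟘 F)))

    T-⊖ : ∀ c → T (⊖ c) ≐ ⊖ T c
    T-⊖ c F = inverseˡ-unique _ _ (begin
      T (⊖ c) F + T c F  ≈⟨ T-⊕ (⊖ c) c F ⟨
      T (⊖ c ⊕ c) F      ≈⟨ T-cong (λ E → -‿inverseˡ (c E)) F ⟩
      T 𝟘 F              ≈⟨ T-𝟘 F ⟩
      0#                 ∎)

  open Linear

  -- ∂ by recursion on the vertex set: splitting a chain at the first vertex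
  -- into c₀ + [0]·c₁ gives ∂c = (∂c₀ + c₁) - [0]·∂c₁.
  d : ∀ {n} → Chain n → Chain n
  d c []            = 0#
  d c (outside ∷ F) = c (inside ∷ F) + d (c ∘ (outside ∷_)) F
  d c (inside ∷ F)  = - d (c ∘ (inside ∷_)) F

  d-linear : ∀ {n} → Linear (d {n})
  d-linear .T-cong p []            = refl
  d-linear .T-cong p (outside ∷ F) = +-cong (p (inside ∷ F)) (d-linear .T-cong (p ∘ (outside ∷_)) F)
  d-linear .T-cong p (inside ∷ F)  = -‿cong (d-linear .T-cong (p ∘ (inside ∷_)) F)
  d-linear .T-⊕ c e []            = sym (+-identityʳ 0#)
  d-linear .T-⊕ c e (outside ∷ F) =
    trans (+-congˡ (d-linear .T-⊕ (c ∘ (outside ∷_)) (e ∘ (outside ∷_)) F)) (interchange _ _ _ _)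
  d-linear .T-⊕ c e (inside ∷ F)  =
    trans (-‿cong (d-linear .T-⊕ (c ∘ (inside ∷_)) (e ∘ (inside ∷_)) F)) (sym (⁻¹-∙-comm _ _))

  -sum : ∀ {n} (f : Fin n → Carrier) → sum (λ x → - f x) ≈ - sum f
  -sum {zero}  f = sym ε⁻¹≈ε
  -sum {suc n} f = trans (+-congˡ (-sum (f ∘ suc))) (⁻¹-∙-comm _ _)

  ∂≐d : ∀ {n} (c : Chain n) → ∂ c ≐ d c
  ∂≐d c [] = refl
  ∂≐d {suc n} c (outside ∷ F) = +-cong head (trans (sum-cong-≋ tail) (∂≐d (c ∘ (outside ∷_)) F))
    where
    head : (- 1#) ^ position {suc n} zero (outside ∷ F) * c (inside ∷ (F ∪ ⊥)) ≈ c (inside ∷ F)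
    -- No vertex lies below `zero`, so its position is 0 and its sign is `1#`.
    head rewrite ∣p∩⊥∣≡0 F | ∪-identityʳ F = *-identityˡ _
    tail : ∀ x → (if does (suc x ∈? (outside ∷ F)) then 0# else
                    (- 1#) ^ position (suc x) (outside ∷ F) * c (outside ∷ (F ∪ ⁅ x ⁆)))
               ≈ (if does (x ∈? F) then 0# else
                    (- 1#) ^ position x F * c (outside ∷ (F ∪ ⁅ x ⁆)))
    tail x = refl
  ∂≐d {suc n} c (inside ∷ F) = begin
    0# + sum term′   ≈⟨ +-identityˡ _ ⟩
    sum term′        ≈⟨ sum-cong-≋ tail ⟩
    sum (λ x → - term x)  ≈⟨ -sum term ⟩
    - sum term       ≈⟨ -‿cong (∂≐d (c ∘ (inside ∷_)) F) ⟩
    - d (c ∘ (inside ∷_)) F ∎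
    where
    term term′ : Fin n → Carrier
    term x = if does (x ∈? F) then 0# else (- 1#) ^ position x F * c (inside ∷ (F ∪ ⁅ x ⁆))
    term′ x = if does (suc x ∈? (inside ∷ F)) then 0# else
                (- 1#) ^ position (suc x) (inside ∷ F) * c (inside ∷ (F ∪ ⁅ x ⁆))
    tail : ∀ x → term′ x ≈ - term x
    tail x with does (x ∈? F)
    ... | true  = sym ε⁻¹≈ε
    -- The vertex `zero` of the face lies below `suc x`: the position rises by one, which
    -- contributes the factor `- 1#`.
    ... | false = begin
      (- 1# * s) * e  ≈⟨ *-congʳ (-‿distribˡ-* 1# s) ⟨
      - (1# * s) * e  ≈⟨ *-congʳ (-‿cong (*-identityˡ s)) ⟩
      - s * e         ≈⟨ -‿distribˡ-* s e ⟨
      - (s * e)       ∎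
      where
      s = (- 1#) ^ position x F
      e = c (inside ∷ (F ∪ ⁅ x ⁆))

  -- With the sign of the ordered basis: cone v is multiplication by [v] (zero
  -- on faces that contain v), link v is its partial inverse, and delete v
  -- discards the faces that contain v.
  cone link delete : ∀ {n} → Fin n → Chain n → Chain n

  cone zero    c (outside ∷ F) = 0#
  cone zero    c (inside ∷ F)  = c (outside ∷ F)
  cone (suc v) c (outside ∷ F) = cone v (c ∘ (outside ∷_)) F
  cone (suc v) c (inside ∷ F)  = - cone v (c ∘ (inside ∷_)) F

  link zero    c (outside ∷ F) = c (inside ∷ F)
  link zero    c (inside ∷ F)  = 0#
  link (suc v) c (outside ∷ F) = link v (c ∘ (outside ∷_)) F
  link (suc v) c (inside ∷ F)  = - link v (c ∘ (inside ∷_)) F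

  delete zero    c (outside ∷ F) = c (outside ∷ F)
  delete zero    c (inside ∷ F)  = 0#
  delete (suc v) c (s ∷ F)       = delete v (c ∘ (s ∷_)) F

  cone-linear : ∀ {n} (v : Fin n) → Linear (cone v)
  cone-linear zero    .T-cong p (outside ∷ F) = refl
  cone-linear zero    .T-cong p (inside ∷ F)  = p _
  cone-linear (suc v) .T-cong p (outside ∷ F) = cone-linear v .T-cong (p ∘ (outside ∷_)) F
  cone-linear (suc v) .T-cong p (inside ∷ F)  = -‿cong (cone-linear v .T-cong (p ∘ (inside ∷_)) F)
  cone-linear zero    .T-⊕ c e (outside ∷ F) = sym (+-identityʳ 0#)
  cone-linear zero    .T-⊕ c e (inside ∷ F)  = refl
  cone-linear (suc v) .T-⊕ c e (outside ∷ F) =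
    cone-linear v .T-⊕ (c ∘ (outside ∷_)) (e ∘ (outside ∷_)) F
  cone-linear (suc v) .T-⊕ c e (inside ∷ F)  =
    trans (-‿cong (cone-linear v .T-⊕ (c ∘ (inside ∷_)) (e ∘ (inside ∷_)) F)) (sym (⁻¹-∙-comm _ _))

  link-linear : ∀ {n} (v : Fin n) → Linear (link v)
  link-linear zero    .T-cong p (outside ∷ F) = p _
  link-linear zero    .T-cong p (inside ∷ F)  = refl
  link-linear (suc v) .T-cong p (outside ∷ F) = link-linear v .T-cong (p ∘ (outside ∷_)) F
  link-linear (suc v) .T-cong p (inside ∷ F)  = -‿cong (link-linear v .T-cong (p ∘ (inside ∷_)) F)
  link-linear zero    .T-⊕ c e (outside ∷ F) = refl
  link-linear zero    .T-⊕ c e (inside ∷ F)  = sym (+-identityʳ 0#)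
  link-linear (suc v) .T-⊕ c e (outside ∷ F) =
    link-linear v .T-⊕ (c ∘ (outside ∷_)) (e ∘ (outside ∷_)) F
  link-linear (suc v) .T-⊕ c e (inside ∷ F)  =
    trans (-‿cong (link-linear v .T-⊕ (c ∘ (inside ∷_)) (e ∘ (inside ∷_)) F)) (sym (⁻¹-∙-comm _ _))

  delete-linear : ∀ {n} (v : Fin n) → Linear (delete v)
  delete-linear zero    .T-cong p (outside ∷ F) = p _
  delete-linear zero    .T-cong p (inside ∷ F)  = refl
  delete-linear (suc v) .T-cong p (s ∷ F)       = delete-linear v .T-cong (p ∘ (s ∷_)) F
  delete-linear zero    .T-⊕ c e (outside ∷ F) = refl
  delete-linear zero    .T-⊕ c e (inside ∷ F)  = sym (+-identityʳ 0#)
  delete-linear (suc v) .T-⊕ c e (s ∷ F)       = delete-linear v .T-⊕ (c ∘ (s ∷_)) (e ∘ (s ∷_)) F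

  private
    cancel-middle : ∀ a b c → (- a + b) + (a + c) ≈ b + c
    cancel-middle a b c = begin
      (- a + b) + (a + c)  ≈⟨ interchange (- a) b a c ⟩
      (- a + a) + (b + c)  ≈⟨ +-congʳ (-‿inverseˡ a) ⟩
      0# + (b + c)         ≈⟨ +-identityˡ _ ⟩
      b + c                ∎

    0+0≈0 : ∀ {a b} → a ≈ 0# → b ≈ 0# → a + b ≈ 0#
    0+0≈0 p q = trans (+-cong p q) (+-identityʳ 0#)

    -0≈0 : ∀ {a} → a ≈ 0# → - a ≈ 0#
    -0≈0 p = trans (-‿cong p) ε⁻¹≈ε

    -‿swap : ∀ {a b} → a ≈ - b → - a ≈ b
    -‿swap p = trans (-‿cong p) (⁻¹-involutive _)

  -- The Leibniz rule for multiplication by [v]: `cone v` is a chain homotopy from the identity to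
  -- zero on the full simplex.
  d-cone : ∀ {n} (v : Fin n) c → d (cone v c) ⊕ cone v (d c) ≐ c
  d-cone zero c (outside ∷ F) = begin
    (c (outside ∷ F) + d 𝟘 F) + 0#  ≈⟨ +-identityʳ _ ⟩
    c (outside ∷ F) + d 𝟘 F         ≈⟨ +-congˡ (T-𝟘 d-linear F) ⟩
    c (outside ∷ F) + 0#            ≈⟨ +-identityʳ _ ⟩
    c (outside ∷ F)                 ∎
  d-cone zero c (inside ∷ F) = begin
    - a + (b + a)  ≈⟨ +-congˡ (+-comm b a) ⟩
    - a + (a + b)  ≈⟨ +-assoc _ _ _ ⟨
    (- a + a) + b  ≈⟨ +-congʳ (-‿inverseˡ a) ⟩
    0# + b         ≈⟨ +-identityˡ b ⟩
    b              ∎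
    where
    a = d (c ∘ (outside ∷_)) F
    b = c (inside ∷ F)
  d-cone (suc v) c (outside ∷ F) =
    trans (+-congˡ (cone-linear v .T-⊕ _ _ F)) (trans (cancel-middle _ _ _) (d-cone v _ F))
  d-cone (suc v) c (inside ∷ F) =
    trans (+-cong (-‿swap (T-⊖ d-linear _ F)) (-‿swap (T-⊖ (cone-linear v) _ F)))
          (d-cone v _ F)

  -- In the exterior algebra on the vertices `link v` is a contraction and `d` is the sum of all of
  -- these, and contractions anticommute.
  d-link : ∀ {n} (v : Fin n) c → d (link v c) ⊕ link v (d c) ≐ 𝟘
  d-link zero c (outside ∷ F) = trans (+-congʳ (+-identityˡ _)) (-‿inverseʳ _)
  d-link zero c (inside ∷ F)  = 0+0≈0 (-0≈0 (T-𝟘 d-linear F)) refl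
  d-link (suc v) c (outside ∷ F) =
    trans (+-congˡ (link-linear v .T-⊕ _ _ F)) (trans (cancel-middle _ _ _) (d-link v _ F))
  d-link (suc v) c (inside ∷ F) =
    trans (+-cong (-‿swap (T-⊖ d-linear _ F)) (-‿swap (T-⊖ (link-linear v) _ F)))
          (d-link v _ F)

  -- A face without `v` in the boundary of `c` comes either from a face without `v` or, by removing
  -- `v`, from one that contains it; the latter contribute `link v c`.
  d-delete : ∀ {n} (v : Fin n) c → d (delete v c) ⊕ link v c ≐ delete v (d c)
  d-delete zero c (outside ∷ F) = trans (+-congʳ (+-identityˡ _)) (+-comm _ _)
  d-delete zero c (inside ∷ F)  = 0+0≈0 (-0≈0 (T-𝟘 d-linear F)) refl
  d-delete (suc v) c (outside ∷ F) =
    trans (+-assoc _ _ _)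
      (trans (+-congˡ (d-delete v _ F)) (sym (delete-linear v .T-⊕ _ _ F)))
  d-delete (suc v) c (inside ∷ F) =
    trans (⁻¹-∙-comm _ _) (trans (-‿cong (d-delete v _ F)) (sym (T-⊖ (delete-linear v) _ F)))

  delete-cone-link : ∀ {n} (v : Fin n) c → delete v c ⊕ cone v (link v c) ≐ c
  delete-cone-link zero    c (outside ∷ F) = +-identityʳ _
  delete-cone-link zero    c (inside ∷ F)  = +-identityˡ _
  delete-cone-link (suc v) c (outside ∷ F) = delete-cone-link v _ F
  delete-cone-link (suc v) c (inside ∷ F)  =
    trans (+-congˡ (-‿swap (T-⊖ (cone-linear v) _ F))) (delete-cone-link v _ F)

  cone-bounds : ∀ {n} (v : Fin n) {z} → d z ≐ 𝟘 → d (cone v z) ≐ z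
  cone-bounds v {z} dz F = begin
    d (cone v z) F                       ≈⟨ +-identityʳ _ ⟨
    d (cone v z) F + 0#                  ≈⟨ +-congˡ (trans (cone-linear v .T-cong dz F) (T-𝟘 (cone-linear v) F)) ⟨
    d (cone v z) F + cone v (d z) F      ≈⟨ d-cone v z F ⟩
    z F                                  ∎

  link-cycle : ∀ {n} (v : Fin n) {z} → d z ≐ 𝟘 → d (link v z) ≐ 𝟘
  link-cycle v {z} dz F = begin
    d (link v z) F                   ≈⟨ +-identityʳ _ ⟨
    d (link v z) F + 0#              ≈⟨ +-congˡ (trans (link-linear v .T-cong dz F) (T-𝟘 (link-linear v) F)) ⟨
    d (link v z) F + link v (d z) F  ≈⟨ d-link v z F ⟩
    0#                               ∎

  -- For a cycle `z` the boundary of `delete v z` is minus the link, so any filling `w` of the link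
  -- closes it up.
  delete-cycle : ∀ {n} (v : Fin n) {z w} → d z ≐ 𝟘 → d w ≐ link v z → d (delete v z ⊕ w) ≐ 𝟘
  delete-cycle v {z} {w} dz dw F = begin
    d (delete v z ⊕ w) F           ≈⟨ d-linear .T-⊕ _ _ F ⟩
    d (delete v z) F + d w F       ≈⟨ +-congˡ (dw F) ⟩
    d (delete v z) F + link v z F  ≈⟨ d-delete v z F ⟩
    delete v (d z) F               ≈⟨ delete-linear v .T-cong dz F ⟩
    delete v 𝟘 F                   ≈⟨ T-𝟘 (delete-linear v) F ⟩
    0#                             ∎

  -- Exactness of the sequence of the pair (deletion, link) at the middle term.
  glue-bounds : ∀ {n} (v : Fin n) {z w w′} → d w ≐ link v z → d w′ ≐ delete v z ⊕ w →
                d (w′ ⊕ ⊖ cone v w) ≐ z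
  glue-bounds v {z} {w} {w′} dw dw′ F = begin
    d (w′ ⊕ ⊖ cone v w) F                            ≈⟨ d-linear .T-⊕ _ _ F ⟩
    d w′ F + d (⊖ cone v w) F                        ≈⟨ +-cong (dw′ F) (T-⊖ d-linear _ F) ⟩
    (delete v z F + w F) + - d (cone v w) F          ≈⟨ +-assoc _ _ _ ⟩
    -- Expanding `w` by the Leibniz rule cancels `d (cone v w)` and leaves the cone over `d w`, the
    -- link of `z`.
    delete v z F + (w F + - d (cone v w) F)          ≈⟨ +-congˡ (+-congʳ (d-cone v w F)) ⟨
    delete v z F + (d (cone v w) F + cone v (d w) F + - d (cone v w) F)
                                                     ≈⟨ +-congˡ (xyx⁻¹≈y _ _) ⟩
    delete v z F + cone v (d w) F                    ≈⟨ +-congˡ (cone-linear v .T-cong dw F) ⟩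
    delete v z F + cone v (link v z) F               ≈⟨ delete-cone-link v z F ⟩
    z F                                              ∎

  -- Each of the three operators takes at `F` either zero or, up to sign, one value of `c`; the
  -- premise concerns only the faces of the second kind.
  cone-support : ∀ {n} (v : Fin n) c F →
    (v ∈ F → c (F [ v ]≔ outside) ≈ 0#) → cone v c F ≈ 0#
  cone-support zero    c (outside ∷ F) p = refl
  cone-support zero    c (inside ∷ F)  p = p here
  cone-support (suc v) c (outside ∷ F) p = cone-support v _ F (p ∘ there)
  cone-support (suc v) c (inside ∷ F)  p = -0≈0 (cone-support v _ F (p ∘ there))

  link-support : ∀ {n} (v : Fin n) c F →
    (v ∉ F → c (F [ v ]≔ inside) ≈ 0#) → link v c F ≈ 0#
  link-support zero    c (outside ∷ F) p = p λ ()
  link-support zero    c (inside ∷ F)  p = refl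
  link-support (suc v) c (outside ∷ F) p = link-support v _ F (λ v∉F → p (v∉F ∘ drop-there))
  link-support (suc v) c (inside ∷ F)  p = -0≈0 (link-support v _ F (λ v∉F → p (v∉F ∘ drop-there)))

  delete-support : ∀ {n} (v : Fin n) c F → (v ∉ F → c F ≈ 0#) → delete v c F ≈ 0#
  delete-support zero    c (outside ∷ F) p = p λ ()
  delete-support zero    c (inside ∷ F)  p = refl
  delete-support (suc v) c (s ∷ F)       p = delete-support v _ F (λ v∉F → p (v∉F ∘ drop-there))

  cone-reflects-0 : ∀ {n} (v : Fin n) c F → v ∉ F → cone v c (F [ v ]≔ inside) ≈ 0# → c F ≈ 0#
  cone-reflects-0 zero    c (outside ∷ F) v∉F p = p
  cone-reflects-0 zero    c (inside ∷ F)  v∉F p = contradiction here v∉F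
  cone-reflects-0 (suc v) c (outside ∷ F) v∉F p = cone-reflects-0 v _ F (v∉F ∘ there) p
  cone-reflects-0 (suc v) c (inside ∷ F)  v∉F p =
    cone-reflects-0 v _ F (v∉F ∘ there) (trans (sym (⁻¹-involutive _)) (-0≈0 p))

  -- The generator in degree -1, which is the fundamental cycle of the empty sphere.
  [∅] : ∀ {n} → Chain n
  [∅] []            = 1#
  [∅] (outside ∷ F) = [∅] F
  [∅] (inside ∷ F)  = 0#

  [∅]-⊥ : ∀ n → [∅] {n} ⊥ ≈ 1#
  [∅]-⊥ zero    = refl
  [∅]-⊥ (suc n) = [∅]-⊥ n

  [∅]-support : ∀ {n} (F : Subset n) → F ≢ ⊥ → [∅] F ≈ 0#
  [∅]-support []            F≢⊥ = contradiction ≡.refl F≢⊥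
  [∅]-support (outside ∷ F) F≢⊥ = [∅]-support F λ { ≡.refl → F≢⊥ ≡.refl }
  [∅]-support (inside ∷ F)  F≢⊥ = refl

  d-[∅] : ∀ {n} → d ([∅] {n}) ≐ 𝟘
  d-[∅] []            = refl
  d-[∅] (outside ∷ F) = 0+0≈0 refl (d-[∅] F)
  d-[∅] (inside ∷ F)  = -0≈0 (T-𝟘 d-linear F)

-- Induced matchings

-- The last premise says that the sets of indices related to the members of `U` are linearly ordered
-- by inclusion. The least of them is empty, or else each of its elements lies in all the others.
avoid-or-dominate : ∀ {m n} (U : Subset n) {R : Fin n → Fin m → Set} →
  (∀ u i → Dec (R u i)) → Nonempty U →
  (∀ {u u′ i i′} → u ∈ U → u′ ∈ U → R u i → R u′ i′ → ¬ R u i′ → R u′ i) →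
  (∃[ u ] (u ∈ U × ∀ i → ¬ R u i)) ⊎ (∃[ i ] ∀ u → u ∈ U → R u i)
avoid-or-dominate {zero}  U R? (u , u∈U) chain = inj₁ (u , u∈U , λ ())
avoid-or-dominate {suc m} U R? ne chain
  with avoid-or-dominate U (λ u → R? u ∘ suc) ne chain
... | inj₂ (i , dom) = inj₂ (suc i , dom)
... | inj₁ (u , u∈U , none) with R? u zero
...   | no ¬r = inj₁ (u , u∈U , λ { zero → ¬r ; (suc i) → none i })
-- Here `u` is related to `zero` only, so a `u′` that misses `zero` must be related to nothing.
...   | yes r with any? (λ u′ → (u′ ∈? U) ×-dec ¬? (R? u′ zero))
...     | no ¬∃ = inj₂ (zero , λ u′ u′∈U →
                    decidable-stable (R? u′ zero) λ ¬r′ → ¬∃ (u′ , u′∈U , ¬r′))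
...     | yes (u′ , u′∈U , ¬r′) with any? (λ i → R? u′ (suc i))
...       | yes (i , r′) = contradiction (chain u′∈U u∈U r′ r ¬r′) (none i)
...       | no ¬∃ = inj₁ (u′ , u′∈U , λ { zero → ¬r′ ; (suc i) r′ → ¬∃ (i , r′) })

-- Decided by exhaustion. On a graph without twins a map that preserves and reflects adjacency is
-- injective, so an induced path is found by checking adjacencies alone.
path6-twin-free : (i j : Fin 6) →
  (∀ k → (Graph.Adj (path 6) i k → Graph.Adj (path 6) j k)
       × (Graph.Adj (path 6) j k → Graph.Adj (path 6) i k)) → i ≡ j
path6-twin-free = from-yes (all? λ i → all? λ j →
  (all? λ k → (adj? i k →-dec adj? j k) ×-dec (adj? j k →-dec adj? i k)) →-dec (i ≟ j))
  where open Graph (path 6)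

module _ {n : ℕ} (G : Graph n) where
  open Graph G

  neighbours : Fin n → Subset n → Subset n
  neighbours v S = select λ x → (x ∈? S) ×-dec adj? v x

  -- For `v` in `S` this is S - N[v], and its independence complex is the link of `v` in `Ind G S`.
  remote : Fin n → Subset n → Subset n
  remote v S = select λ x → (x ∈? S) ×-dec (¬? (x ≟ v) ×-dec ¬? (adj? v x))

  ∈-neighbours⁺ : ∀ {v S x} → x ∈ S → Adj v x → x ∈ neighbours v S
  ∈-neighbours⁺ {v} {S} x∈S v~x = ∈-select⁺ (λ x → (x ∈? S) ×-dec adj? v x) (x∈S , v~x)

  ∈-neighbours⁻ : ∀ {v S x} → x ∈ neighbours v S → x ∈ S × Adj v x
  ∈-neighbours⁻ {v} {S} = ∈-select⁻ (λ x → (x ∈? S) ×-dec adj? v x)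

  ∈-remote⁺ : ∀ {v S x} → x ∈ S → x ≢ v → ¬ Adj v x → x ∈ remote v S
  ∈-remote⁺ {v} {S} x∈S x≢v v≁x =
    ∈-select⁺ (λ x → (x ∈? S) ×-dec (¬? (x ≟ v) ×-dec ¬? (adj? v x))) (x∈S , x≢v , v≁x)

  ∈-remote⁻ : ∀ {v S x} → x ∈ remote v S → x ∈ S × x ≢ v × ¬ Adj v x
  ∈-remote⁻ {v} {S} = ∈-select⁻ (λ x → (x ∈? S) ×-dec (¬? (x ≟ v) ×-dec ¬? (adj? v x)))

  IsInducedMatching-resp : ∀ {m e e′} → (∀ i → e i ≡ e′ i) → IsInducedMatching G m e → IsInducedMatching G m e′
  IsInducedMatching-resp e≡e′ (adj , ind) =
    (λ i → subst (λ p → Adj (proj₁ p) (proj₂ p)) (e≡e′ i) (adj i)) ,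
    λ i j i≢j u v u∈ v∈ → ind i j i≢j u v
      (subst (λ p → u ≡ proj₁ p ⊎ u ≡ proj₂ p) (≡.sym (e≡e′ i)) u∈)
      (subst (λ p → v ≡ proj₁ p ⊎ v ≡ proj₂ p) (≡.sym (e≡e′ j)) v∈)

  isInducedMatching? : ∀ m e → Dec (IsInducedMatching G m e)
  isInducedMatching? m e =
    all? (λ i → adj? _ _) ×-dec
    all? λ i → all? λ j → ¬? (i ≟ j) →-dec
      all? λ u → all? λ v → ((u ≟ _) ⊎-dec (u ≟ _)) →-dec ((v ≟ _) ⊎-dec (v ≟ _)) →-dec
        (¬? (u ≟ v) ×-dec ¬? (adj? u v))

  anyVec? : ∀ m {P : Vec (Fin n × Fin n) m → Set} → Decidable P → Dec (∃ P)
  anyVec? zero    P? = map′ (λ p → [] , p) (λ { ([] , p) → p }) (P? [])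
  anyVec? (suc m) P? =
    map′ (λ { (u , v , es , p) → (u , v) ∷ es , p }) (λ { ((u , v) ∷ es , p) → u , v , es , p })
      (any? λ u → any? λ v → anyVec? m λ es → P? ((u , v) ∷ es))

  -- Functions on `Fin m` are searched through their tabulations, and `IsInducedMatching-resp`
  -- transfers the property along pointwise equality.
  hasInducedMatching? : ∀ m → Dec (∃[ e ] IsInducedMatching G m e)
  hasInducedMatching? m = map′ (λ (es , im) → lookup es , im)
    (λ (e , im) → tabulate e , IsInducedMatching-resp (λ i → ≡.sym (lookup∘tabulate e i)) im)
    (anyVec? m (isInducedMatching? m ∘ lookup))

  inducedMatching-size≤n : ∀ {m e} → IsInducedMatching G m e → m ≤ n
  inducedMatching-size≤n {e = e} (_ , ind) = injective⇒≤ {f = proj₁ ∘ e} λ {i} {j} eq →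
    decidable-stable (i ≟ j) λ i≢j → proj₁ (ind i j i≢j _ _ (inj₁ ≡.refl) (inj₁ ≡.refl)) eq

  inducedMatching-tail : ∀ {m e} → IsInducedMatching G (suc m) e → IsInducedMatching G m (e ∘ suc)
  inducedMatching-tail (adj , ind) = adj ∘ suc , λ i j i≢j → ind (suc i) (suc j) λ { ≡.refl → i≢j ≡.refl }

-- Induced matchings in bipartite graphs

module Bip {n : ℕ} (G : Graph n) (bip : Bipartite G) where
  open Graph G

  side : Fin n → Bool
  side x = does (x ∈? proj₁ bip)

  adj⇒side : ∀ {x y} → Adj x y → side x ≢ side y
  adj⇒side {x} {y} adj eq with x ∈? proj₁ bip | y ∈? proj₁ bip
  ... | yes x∈ | yes y∈ = proj₁ (proj₂ bip) x y x∈ y∈ adj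
  ... | no  x∉ | no  y∉ = proj₂ (proj₂ bip) x y (x∉p⇒x∈∁p x∉) (x∉p⇒x∈∁p y∉) adj

  adj⇒opposite : ∀ {x y β} → Adj x y → side x ≡ β → side y ≡ not β
  adj⇒opposite adj ≡.refl = ¬-not (adj⇒side (adj-sym adj))

  -- With all `a i` on one side, vertices of the same side are non-adjacent by bipartiteness, so
  -- `induced` constrains only the crossing pairs; disjointness of the edges follows.
  record Matching (β : Bool) (S : Subset n) (m : ℕ) : Set where
    field
      a b     : Fin m → Fin n
      a∈S     : ∀ i → a i ∈ S
      b∈S     : ∀ i → b i ∈ S
      a-side  : ∀ i → side (a i) ≡ β
      edge    : ∀ i → Adj (a i) (b i)
      induced : ∀ i j → i ≢ j → ¬ Adj (a i) (b j)

    b-side : ∀ i → side (b i) ≡ not β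
    b-side i = adj⇒opposite (edge i) (a-side i)

    isInducedMatching : IsInducedMatching G m (λ i → a i , b i)
    isInducedMatching = edge , λ
      { i j i≢j _ _ (inj₁ ≡.refl) (inj₁ ≡.refl) →
          (λ eq → induced i j i≢j (subst (λ x → Adj x (b j)) (≡.sym eq) (edge j))) ,
          (λ adj → adj⇒side adj (≡.trans (a-side i) (≡.sym (a-side j))))
      ; i j i≢j _ _ (inj₁ ≡.refl) (inj₂ ≡.refl) →
          (λ eq → not-¬ (≡.trans (cong side (≡.sym eq)) (a-side i)) (b-side j)) , induced i j i≢j
      ; i j i≢j _ _ (inj₂ ≡.refl) (inj₁ ≡.refl) →
          (λ eq → not-¬ (≡.trans (cong side eq) (a-side j)) (b-side i)) ,
          induced j i (i≢j ∘ ≡.sym) ∘ adj-sym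
      ; i j i≢j _ _ (inj₂ ≡.refl) (inj₂ ≡.refl) →
          (λ eq → induced i j i≢j (subst (Adj (a i)) eq (edge i))) ,
          (λ adj → adj⇒side adj (≡.trans (b-side i) (≡.sym (b-side j)))) }

  opposite : ∀ {β S m} → Matching β S m → Matching (not β) S m
  opposite M = record
    { a = b ; b = a ; a∈S = b∈S ; b∈S = a∈S ; a-side = b-side ; edge = adj-sym ∘ edge
    ; induced = λ i j i≢j → induced j i (i≢j ∘ ≡.sym) ∘ adj-sym }
    where open Matching M

  -- Lets the induction fix the side `true`, whereas `grow` works with the side of the chosen
  -- vertex.
  recolour : ∀ β γ {S m} → Matching β S m → Matching γ S m
  recolour true  true  = id
  recolour true  false = opposite
  recolour false true  = opposite
  recolour false false = id

  Matching-mono : ∀ {β S S′ m} → S ⊆ S′ → Matching β S m → Matching β S′ m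
  Matching-mono S⊆S′ M = record
    { a = a ; b = b ; a∈S = S⊆S′ ∘ a∈S ; b∈S = S⊆S′ ∘ b∈S ; a-side = a-side ; edge = edge
    ; induced = induced }
    where open Matching M

  empty-matching : ∀ {β S} → Matching β S 0
  empty-matching = record
    { a = λ () ; b = λ () ; a∈S = λ () ; b∈S = λ () ; a-side = λ () ; edge = λ () ; induced = λ () }

  extend : ∀ {S v u m} (M : Matching (side v) (remote G v S) m) → v ∈ S → u ∈ S → Adj v u →
           (∀ i → ¬ Adj u (Matching.a M i)) → Matching (side v) S (suc m)
  extend {S} {v} {u} M v∈S u∈S v~u free = record
    { a       = λ { zero → v ; (suc i) → a i }
    ; b       = λ { zero → u ; (suc i) → b i }
    ; a∈S     = λ { zero → v∈S ; (suc i) → proj₁ (∈-remote⁻ G (a∈S i)) }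
    ; b∈S     = λ { zero → u∈S ; (suc i) → proj₁ (∈-remote⁻ G (b∈S i)) }
    ; a-side  = λ { zero → ≡.refl ; (suc i) → a-side i }
    ; edge    = λ { zero → v~u ; (suc i) → edge i }
    ; induced = λ
      { zero    zero    0≢0 _   → 0≢0 ≡.refl
      ; zero    (suc j) _   adj → proj₂ (proj₂ (∈-remote⁻ G (b∈S j))) adj
      ; (suc i) zero    _   adj → free i (adj-sym adj)
      ; (suc i) (suc j) i≢j     → induced i j λ { ≡.refl → i≢j ≡.refl } } }
    where open Matching M

  -- The vertices split three and three between the sides, which leaves nine pairs that could be
  -- adjacent; the hypotheses name five edges and four non-edges.
  induced-path6 : ∀ {b a u v u′ a′} → side a ≡ side v → side a′ ≡ side v →
    Adj b a → Adj a u → Adj u v → Adj v u′ → Adj u′ a′ →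
    ¬ Adj b v → ¬ Adj b a′ → ¬ Adj a u′ → ¬ Adj u a′ → InducedIn (path 6) G
  induced-path6 {b} {a} {u} {v} {u′} {a′} sa sa′ ba au uv vu′ u′a′ ¬bv ¬ba′ ¬au′ ¬ua′ =
    f , injective , iff
    where
    f : Fin 6 → Fin n
    f = lookup (b ∷ a ∷ u ∷ v ∷ u′ ∷ a′ ∷ [])

    sb  = adj⇒opposite (adj-sym ba) sa
    su  = adj⇒opposite au sa
    su′ = adj⇒opposite vu′ ≡.refl

    Agree : Fin 6 → Fin 6 → Set
    Agree i j = Graph.Adj (path 6) i j ⇔ Adj (f i) (f j)

    yes! : ∀ {i j} {_ : True (Graph.adj? (path 6) i j)} → Adj (f i) (f j) → Agree i j
    yes! {_} {_} {p} q = mk⇔ (λ _ → q) (λ _ → toWitness p)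

    no! : ∀ {i j} {_ : False (Graph.adj? (path 6) i j)} → ¬ Adj (f i) (f j) → Agree i j
    no! {_} {_} {p} q = mk⇔ (λ p′ → contradiction p′ (toWitnessFalse p)) (λ q′ → contradiction q′ q)

    same : ∀ {x y β} → side x ≡ β → side y ≡ β → ¬ Adj x y
    same sx sy adj = adj⇒side adj (≡.trans sx (≡.sym sy))

    iff : ∀ i j → Agree i j
    iff 0F 0F = no! (same sb sb)
    iff 0F 1F = yes! ba
    iff 0F 2F = no! (same sb su)
    iff 0F 3F = no! ¬bv
    iff 0F 4F = no! (same sb su′)
    iff 0F 5F = no! ¬ba′
    iff 1F 0F = yes! (adj-sym ba)
    iff 1F 1F = no! (same sa sa)
    iff 1F 2F = yes! au
    iff 1F 3F = no! (same sa ≡.refl)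
    iff 1F 4F = no! ¬au′
    iff 1F 5F = no! (same sa sa′)
    iff 2F 0F = no! (same su sb)
    iff 2F 1F = yes! (adj-sym au)
    iff 2F 2F = no! (same su su)
    iff 2F 3F = yes! uv
    iff 2F 4F = no! (same su su′)
    iff 2F 5F = no! ¬ua′
    iff 3F 0F = no! (¬bv ∘ adj-sym)
    iff 3F 1F = no! (same ≡.refl sa)
    iff 3F 2F = yes! (adj-sym uv)
    iff 3F 3F = no! (same {v} ≡.refl ≡.refl)
    iff 3F 4F = yes! vu′
    iff 3F 5F = no! (same ≡.refl sa′)
    iff 4F 0F = no! (same su′ sb)
    iff 4F 1F = no! (¬au′ ∘ adj-sym)
    iff 4F 2F = no! (same su′ su)
    iff 4F 3F = yes! (adj-sym vu′)
    iff 4F 4F = no! (same su′ su′)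
    iff 4F 5F = yes! u′a′
    iff 5F 0F = no! (¬ba′ ∘ adj-sym)
    iff 5F 1F = no! (same sa′ sa)
    iff 5F 2F = no! (¬ua′ ∘ adj-sym)
    iff 5F 3F = no! (same sa′ ≡.refl)
    iff 5F 4F = yes! (adj-sym u′a′)
    iff 5F 5F = no! (same sa′ sa′)

    injective : ∀ {i j} → f i ≡ f j → i ≡ j
    injective {i} {j} eq = path6-twin-free i j λ k →
      (λ ik → from (iff j k) (subst (λ x → Adj x (f k)) eq (to (iff i k) ik))) ,
      (λ jk → from (iff i k) (subst (λ x → Adj x (f k)) (≡.sym eq) (to (iff j k) jk)))
      where open Equivalence

  grow : ¬ InducedIn (path 6) G → ∀ {S v m} → v ∈ S →
    (∀ x → x ∈ S → ∣ neighbours G x S ∣ ≤ ∣ neighbours G v S ∣) → Nonempty (neighbours G v S) →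
    Matching (side v) (remote G v S) m → Matching (side v) S (suc m)
  grow ¬P₆ {S} {v} v∈S max ne M
    with avoid-or-dominate (neighbours G v S) (λ u i → adj? u (a i)) ne chain
    where
    open Matching M
    chain : ∀ {u u′ i i′} → u ∈ neighbours G v S → u′ ∈ neighbours G v S →
            Adj u (a i) → Adj u′ (a i′) → ¬ Adj u (a i′) → Adj u′ (a i)
    -- Two incomparable neighbours of `v` would give the induced path `b i`, `a i`, `u`, `v`, `u′`,
    -- `a i′`.
    chain {u} {u′} {i} {i′} u∈ u′∈ ui u′i′ ¬ui′ = decidable-stable (adj? u′ (a i)) λ ¬u′i →
      ¬P₆ (induced-path6 {v = v} (a-side i) (a-side i′)
        (adj-sym (edge i)) (adj-sym ui) (adj-sym (proj₂ (∈-neighbours⁻ G u∈)))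
        (proj₂ (∈-neighbours⁻ G u′∈)) u′i′
        (proj₂ (proj₂ (∈-remote⁻ G (b∈S i))) ∘ adj-sym)
        (induced i′ i (λ { ≡.refl → ¬ui′ ui }) ∘ adj-sym)
        (¬u′i ∘ adj-sym) ¬ui′)
  ... | inj₁ (u , u∈ , free) =
        extend M v∈S (proj₁ (∈-neighbours⁻ G u∈)) (proj₂ (∈-neighbours⁻ G u∈)) free
  -- `a i` has all neighbours of `v` and also `b i`, against the maximality of the degree of `v`.
  ... | inj₂ (i , dom) = contradiction (max (a i) (proj₁ (∈-remote⁻ G (a∈S i))))
        (<⇒≱ (p⊂q⇒∣p∣<∣q∣ (N⊆ , b i , b∈N , b∉N)))
    where
    open Matching M
    N⊆ : neighbours G v S ⊆ neighbours G (a i) S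
    N⊆ {x} x∈ = ∈-neighbours⁺ G (proj₁ (∈-neighbours⁻ G x∈)) (adj-sym (dom x x∈))
    b∈N = ∈-neighbours⁺ G (proj₁ (∈-remote⁻ G (b∈S i))) (edge i)
    b∉N : b i ∉ neighbours G v S
    b∉N b∈ = proj₂ (proj₂ (∈-remote⁻ G (b∈S i))) (proj₂ (∈-neighbours⁻ G b∈))

-- Homology of independence complexes

module IndChains {c ℓ} (R : CommutativeRing c ℓ) {n} (G : Graph n) where
  open CommutativeRing R hiding (zero; _-_)
  open Homology R
  open Chains R
  open Graph G
  open Sum +-monoid using (sum; sum-cong-≋; sum-replicate-zero)
  open AbelianGroupProperties +-abelianGroup using (ε⁻¹≈ε)
  open Exp semiring using (_^_)

  Face : Subset n → Subset n → Set
  Face S = SimplicialComplex.Face (Ind G S)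

  IsChain-⊕ : ∀ {S j w z} → IsChain (Ind G S) j w → IsChain (Ind G S) j z →
              IsChain (Ind G S) j (w ⊕ z)
  IsChain-⊕ w z F ¬f = trans (+-cong (w F ¬f) (z F ¬f)) (+-identityʳ 0#)

  IsChain-⊖ : ∀ {S j z} → IsChain (Ind G S) j z → IsChain (Ind G S) j (⊖ z)
  IsChain-⊖ z F ¬f = trans (-‿cong (z F ¬f)) ε⁻¹≈ε

  IsChain-mono : ∀ {S S′ j z} → S ⊆ S′ → IsChain (Ind G S) j z → IsChain (Ind G S′) j z
  IsChain-mono S⊆S′ z F ¬f = z F λ ((F⊆S , ind) , ∣F∣≡j) → ¬f ((⊆-trans F⊆S S⊆S′ , ind) , ∣F∣≡j)

  IsChain-cone : ∀ {S S′ v j z} → S ⊆ S′ → v ∈ S′ → (∀ {u} → u ∈ S → ¬ Adj v u) →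
                 IsChain (Ind G S) j z → IsChain (Ind G S′) (suc j) (cone v z)
  IsChain-cone {S} {S′} {v} {j} {z} S⊆S′ v∈S′ v≁S zc F ¬f = cone-support v z F λ v∈F →
    zc (F [ v ]≔ outside) λ ((F′⊆S , ind) , size) →
      ¬f ((F⊆S′ F′⊆S , ind′ F′⊆S ind) , ≡.trans (∣remove∣ F v v∈F) (cong suc size))
    where
    ∈F : ∀ {x} → x ∈ F → x ≡ v ⊎ x ∈ F [ v ]≔ outside
    ∈F {x} x∈F with x ≟ v
    ... | yes x≡v = inj₁ x≡v
    ... | no  x≢v = inj₂ ([]≔-minimal F x v x≢v x∈F)
    F⊆S′ : F [ v ]≔ outside ⊆ S → F ⊆ S′
    F⊆S′ F′⊆S x∈F with ∈F x∈F
    ... | inj₁ ≡.refl = v∈S′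
    ... | inj₂ x∈F′   = S⊆S′ (F′⊆S x∈F′)
    ind′ : F [ v ]≔ outside ⊆ S → Independent G (F [ v ]≔ outside) → Independent G F
    ind′ F′⊆S ind x y x∈F y∈F adj with ∈F x∈F | ∈F y∈F
    ... | inj₁ ≡.refl | inj₁ ≡.refl = adj-irrefl ≡.refl adj
    ... | inj₁ ≡.refl | inj₂ y∈     = v≁S (F′⊆S y∈) adj
    ... | inj₂ x∈     | inj₁ ≡.refl = v≁S (F′⊆S x∈) (adj-sym adj)
    ... | inj₂ x∈     | inj₂ y∈     = ind x y x∈ y∈ adj

  -- If adding `v` to `F` gives an independent set, then `F` avoids the neighbours of `v`.
  IsChain-link : ∀ {S v j z} → IsChain (Ind G S) (suc j) z →
                 IsChain (Ind G (remote G v S)) j (link v z)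
  IsChain-link {S} {v} {j} {z} zc F ¬f = link-support v z F λ v∉F →
    zc (F [ v ]≔ inside) λ ((F′⊆S , ind) , size) →
      ¬f (((λ {x} x∈F → ∈-remote⁺ G (F′⊆S (∈-insert⁺ F v x∈F)) (λ { ≡.refl → v∉F x∈F })
              (ind v x ([]≔-updates F v) (∈-insert⁺ F v x∈F)))
          , λ x y x∈F y∈F → ind x y (∈-insert⁺ F v x∈F) (∈-insert⁺ F v y∈F))
         , suc-injective (≡.trans (≡.sym (∣insert∣ F v v∉F)) size))

  IsChain-delete : ∀ {S v j z} → IsChain (Ind G S) j z →
                   IsChain (Ind G (S - v)) j (delete v z)
  IsChain-delete {S} {v} {j} {z} zc F ¬f = delete-support v z F λ v∉F →
    zc F λ ((F⊆S , ind) , size) →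
      ¬f (((λ x∈F → x∈p∧x≢y⇒x∈p-y (F⊆S x∈F) λ { ≡.refl → v∉F x∈F }) , ind) , size)

  Bounds : Subset n → ℕ → Chain n → Set _
  Bounds S j z = ∃[ w ] (IsChain (Ind G S) (suc j) w × d w ≐ z)

  -- Upper bound: filling cycles

  module _ (bip : Bipartite G) (¬P₆ : ¬ InducedIn (path 6) G) where
    open Bip G bip

    -- Well-founded induction on `S`, constructing the filling. Degree 0 is vacuous because the
    -- empty matching always exists.
    cycle-bounds : ∀ S → Acc _⊂_ S → ∀ j → ¬ Matching true S j → ∀ {z} →
      IsChain (Ind G S) j z → d z ≐ 𝟘 → Bounds S j z
    cycle-bounds S _ zero none _ _ = contradiction empty-matching none
    cycle-bounds S (acc rec) (suc j) none {z} zc dz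
      with any? (λ v → (v ∈? S) ×-dec ¬? (nonempty? (neighbours G v S)))
    ... | yes (v , v∈S , isolated) =
          cone v z ,
          IsChain-cone id v∈S (λ u∈S adj → isolated (_ , ∈-neighbours⁺ G u∈S adj)) zc ,
          cone-bounds v dz
    ... | no ¬isolated with nonempty? S
    -- Only the empty face is left, and it has no share in a chain of positive degree, so `z` is
    -- zero.
    ...   | no empty = 𝟘 , (λ _ _ → refl) , λ F → trans (Linear.T-𝟘 d-linear F) (sym (zc F (no-face F)))
          where
          no-face : ∀ F → ¬ (Face S F × ∣ F ∣ ≡ suc j)
          no-face F ((F⊆S , _) , size)
            rewrite Empty-unique (λ (x , x∈F) → empty (x , F⊆S x∈F)) | ∣⊥∣≡0 n with () ← size
    ...   | yes ne with maximiser (λ x → ∣ neighbours G x S ∣) S ne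
    ...     | v , v∈S , max =
              -- `w` fills the link of `z`, one degree lower: by `grow` a matching of size `j` in
              -- the remote part would yield one of size `suc j` in `S`.
              let w , wc , dw = cycle-bounds (remote G v S) (rec remote⊂) j
                    (none ∘ recolour (side v) true ∘ grow ¬P₆ v∈S max nonisolated
                          ∘ recolour true (side v))
                    (IsChain-link zc) (link-cycle v dz)
                  -- `w′` fills the cycle `delete v z ⊕ w` in the same degree, on the smaller vertex
                  -- set `S - v`.
                  w′ , wc′ , dw′ = cycle-bounds (S - v) (rec (x∈p⇒p-x⊂p v∈S)) (suc j)
                    (none ∘ Matching-mono (p─q⊆p S _))
                    (IsChain-⊕ {S = S - v} (IsChain-delete zc) (IsChain-mono remote⊆- wc))
                    (delete-cycle v dz dw)
              in w′ ⊕ ⊖ cone v w ,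
                 IsChain-⊕ {S = S} (IsChain-mono (p─q⊆p S _) wc′)
                   (IsChain-⊖ {S = S} (IsChain-cone remote⊆ v∈S (proj₂ ∘ proj₂ ∘ ∈-remote⁻ G) wc)) ,
                 glue-bounds v dw dw′
          where
          nonisolated : Nonempty (neighbours G v S)
          nonisolated = decidable-stable (nonempty? _) λ isolated → ¬isolated (v , v∈S , isolated)
          remote⊆ : remote G v S ⊆ S
          remote⊆ = proj₁ ∘ ∈-remote⁻ G
          remote⊆- : remote G v S ⊆ S - v
          remote⊆- x∈ = let x∈S , x≢v , _ = ∈-remote⁻ G x∈ in x∈p∧x≢y⇒x∈p-y x∈S x≢v
          remote⊂ : remote G v S ⊂ S
          remote⊂ = remote⊆ , v , v∈S , λ v∈ → proj₁ (proj₂ (∈-remote⁻ G v∈)) ≡.refl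

  -- Lower bound: the sphere of an induced matching

  Edges : ℕ → Set
  Edges m = Fin m → Fin n × Fin n

  ends firsts : ∀ {m} → Edges m → Subset n
  ends {zero}  e = ⊥
  ends {suc m} e = (ends (e ∘ suc) [ proj₁ (e zero) ]≔ inside) [ proj₂ (e zero) ]≔ inside
  firsts {zero}  e = ⊥
  firsts {suc m} e = firsts (e ∘ suc) [ proj₁ (e zero) ]≔ inside

  ∈-ends : ∀ {m} (e : Edges m) {x} → x ∈ ends e → ∃[ i ] (x ≡ proj₁ (e i) ⊎ x ≡ proj₂ (e i))
  ∈-ends {zero}  e x∈ = contradiction x∈ ∉⊥
  ∈-ends {suc m} e x∈ with ∈-insert⁻ _ _ x∈
  ... | inj₁ x≡b = zero , inj₂ x≡b
  ... | inj₂ x∈′ with ∈-insert⁻ _ _ x∈′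
  ...   | inj₁ x≡a = zero , inj₁ x≡a
  ...   | inj₂ x∈″ = map suc id (∈-ends (e ∘ suc) x∈″)

  ∈-firsts⁻ : ∀ {m} (e : Edges m) {x} → x ∈ firsts e → ∃[ i ] x ≡ proj₁ (e i)
  ∈-firsts⁻ {zero}  e x∈ = contradiction x∈ ∉⊥
  ∈-firsts⁻ {suc m} e x∈ with ∈-insert⁻ _ _ x∈
  ... | inj₁ x≡a = zero , x≡a
  ... | inj₂ x∈′ = map suc id (∈-firsts⁻ (e ∘ suc) x∈′)

  ∈-firsts⁺ : ∀ {m} (e : Edges m) i → proj₁ (e i) ∈ firsts e
  ∈-firsts⁺ e zero    = []≔-updates (firsts (e ∘ suc)) _
  ∈-firsts⁺ e (suc i) = ∈-insert⁺ (firsts (e ∘ suc)) _ (∈-firsts⁺ (e ∘ suc) i)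

  -- The join of the 0-spheres on the edges of the matching: its fundamental
  -- cycle is the product of the differences [a] - [b].
  sphere : ∀ {m} → Edges m → Chain n
  sphere {zero}  e = [∅]
  sphere {suc m} e = cone (proj₁ (e zero)) (sphere (e ∘ suc))
                   ⊕ ⊖ cone (proj₂ (e zero)) (sphere (e ∘ suc))

  -- Both cones have the smaller sphere as boundary, so their difference is a cycle.
  d-sphere : ∀ {m} (e : Edges m) → d (sphere e) ≐ 𝟘
  d-sphere {zero}  e = d-[∅]
  d-sphere {suc m} e F =
    trans (Linear.T-⊕ d-linear _ _ F)
      (trans (+-cong (cone-bounds (proj₁ (e zero)) (d-sphere (e ∘ suc)) F)
                     (trans (Linear.T-⊖ d-linear _ F) (-‿cong (cone-bounds (proj₂ (e zero)) (d-sphere (e ∘ suc)) F))))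
             (-‿inverseʳ _))

  sphere-IsChain : ∀ {m} {e : Edges m} → IsInducedMatching G m e →
                   IsChain (Ind G (ends e)) m (sphere e)
  sphere-IsChain {zero} im F ¬f = [∅]-support F λ { ≡.refl →
    ¬f (SimplicialComplex.∅-face (Ind G ⊥) , ∣⊥∣≡0 n) }
  sphere-IsChain {suc m} {e} im@(_ , ind) =
    IsChain-⊕ {S = ends e} (IsChain-cone sub (∈-insert⁺ E₁ _ ([]≔-updates E₀ _)) (≁ends (inj₁ ≡.refl)) rest)
      (IsChain-⊖ {S = ends e} (IsChain-cone sub ([]≔-updates E₁ _) (≁ends (inj₂ ≡.refl)) rest))
    where
    E₀ = ends (e ∘ suc)
    E₁ = E₀ [ proj₁ (e zero) ]≔ inside
    rest = sphere-IsChain (inducedMatching-tail G im)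
    sub : E₀ ⊆ ends e
    sub = ∈-insert⁺ E₁ _ ∘ ∈-insert⁺ E₀ _
    ≁ends : ∀ {v} → v ≡ proj₁ (e zero) ⊎ v ≡ proj₂ (e zero) → ∀ {u} → u ∈ E₀ → ¬ Adj v u
    ≁ends v-end u∈ with i , u-end ← ∈-ends (e ∘ suc) u∈ =
      proj₂ (ind zero (suc i) 0≢1+n _ _ v-end u-end)

  -- The cone over the second end vanishes at `firsts e`, which does not contain that end; the other
  -- cone reduces, up to sign, to the coefficient for the smaller matching.
  sphere-firsts≉0 : 1# ≉ 0# → ∀ {m} {e : Edges m} → IsInducedMatching G m e →
                    sphere e (firsts e) ≉ 0#
  sphere-firsts≉0 1≉0 {zero}  im p = 1≉0 (trans (sym ([∅]-⊥ n)) p)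
  sphere-firsts≉0 1≉0 {suc m} {e} im@(adj , ind) p =
    sphere-firsts≉0 1≉0 (inducedMatching-tail G im) (cone-reflects-0 a (sphere (e ∘ suc)) F₀ a∉
      (trans (sym (trans (+-congˡ (trans (-‿cong b-part) ε⁻¹≈ε)) (+-identityʳ _))) p))
    where
    a  = proj₁ (e zero)
    b  = proj₂ (e zero)
    F₀ = firsts (e ∘ suc)
    a∉ : a ∉ F₀
    a∉ a∈ with i , eq ← ∈-firsts⁻ (e ∘ suc) a∈ =
      proj₁ (ind zero (suc i) 0≢1+n _ _ (inj₁ ≡.refl) (inj₁ ≡.refl)) eq
    b∉ : b ∉ firsts e
    b∉ b∈ with ∈-firsts⁻ e b∈
    ... | zero  , eq = adj-irrefl (≡.sym eq) (adj zero)
    ... | suc i , eq = proj₁ (ind zero (suc i) 0≢1+n _ _ (inj₂ ≡.refl) (inj₁ ≡.refl)) eq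
    b-part : cone b (sphere (e ∘ suc)) (firsts e) ≈ 0#
    b-part = cone-support b _ (firsts e) λ b∈ → contradiction b∈ b∉

  -- Any further vertex of `ends e` is a second end, adjacent to its partner in `firsts e`; so every
  -- summand is read off at a non-face.
  ∂-firsts≈0 : ∀ {m} {e : Edges m} → IsInducedMatching G m e → ∀ {j w} →
               IsChain (Ind G (ends e)) j w → ∂ w (firsts e) ≈ 0#
  ∂-firsts≈0 {m} {e} (adj , _) {j} {w} wc =
    trans (sum-cong-≋ term) (sum-replicate-zero n)
    where
    term : ∀ x → (if does (x ∈? firsts e) then 0# else
                   (- 1#) ^ position x (firsts e) * w (firsts e ∪ ⁅ x ⁆)) ≈ 0#
    term x with x ∈? firsts e
    ... | yes _  = refl
    ... | no x∉ = trans (*-congˡ (wc _ not-face)) (zeroʳ _)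
      where
      x∈∪ : x ∈ firsts e ∪ ⁅ x ⁆
      x∈∪ = q⊆p∪q (firsts e) ⁅ x ⁆ (x∈⁅x⁆ x)
      not-face : ¬ (Face (ends e) (firsts e ∪ ⁅ x ⁆) × ∣ firsts e ∪ ⁅ x ⁆ ∣ ≡ j)
      not-face ((F⊆ , indep) , _) with ∈-ends e (F⊆ x∈∪)
      ... | i , inj₁ ≡.refl = x∉ (∈-firsts⁺ e i)
      ... | i , inj₂ ≡.refl = indep _ _ (p⊆p∪q ⁅ x ⁆ (∈-firsts⁺ e i)) x∈∪ (adj i)

  matching⇒homology : 1# ≉ 0# → ∀ {m} {e : Edges m} → IsInducedMatching G m e →
                      NonzeroReducedHomology (Ind G (ends e)) m
  matching⇒homology 1≉0 {e = e} im =
    sphere e , (sphere-IsChain im , λ F → trans (∂≐d (sphere e) F) (d-sphere e F)) ,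
    λ (w , wc , ∂w) → sphere-firsts≉0 1≉0 im (trans (sym (∂w (firsts e))) (∂-firsts≈0 im wc))

-- Equality of regularity and induced matching number

mainTheorem6 : ∀ {c ℓ₁ ℓ₂} (K : HeytingField c ℓ₁ ℓ₂) {n : ℕ} (G : Graph n) →
    Bipartite G → ¬ InducedIn (path 6) G →
    ∃[ r ] (IsReg K G r × IsIm G r)
mainTheorem6 K {n} G bip ¬P₆ = r , ((ends e , matching⇒homology 1≉0 im) , reg≤) , (e , im) , im≤
  where
  open HeytingField K hiding (zero)
  R = HeytingCommutativeRing.commutativeRing heytingCommutativeRing
  open Homology R
  open Chains R
  open IndChains R G
  open Bip G bip

  max-IM : ∃[ r ] IsIm G r
  max-IM = maximum (hasInducedMatching? G) ((λ ()) , (λ ()) , λ ()) n λ k (e , im) → inducedMatching-size≤n G im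

  r = proj₁ max-IM
  e = proj₁ (proj₁ (proj₂ max-IM))
  im = proj₂ (proj₁ (proj₂ max-IM))
  im≤ = proj₂ (proj₂ max-IM)

  -- The difference of `1#` and `0#` has the inverse `1#`, so the two are apart, and apartness is
  -- irreflexive.
  1≉0 : ¬ 1# ≈ 0#
  1≉0 1≈0 = #-irrefl 1≈0 (invertible⇒# (1# , left , right))
    where
    1-0≈1 : 1# + (- 0#) ≈ 1#
    1-0≈1 = trans (+-congˡ (AbelianGroupProperties.ε⁻¹≈ε (CommutativeRing.+-abelianGroup R))) (+-identityʳ 1#)
    left  = trans (*-congˡ 1-0≈1) (*-identityˡ 1#)
    right = trans (*-congʳ 1-0≈1) (*-identityˡ 1#)

  reg≤ : ∀ k → Σ[ S ∈ Subset n ] NonzeroReducedHomology (Ind G S) k → k ≤ r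
  -- If `k` exceeded `r`, maximality of `r` would exclude a matching of size `k`, and `z` would
  -- bound.
  reg≤ k (S , z , (zc , ∂z) , ¬bd) = decidable-stable (k ≤? r) λ k≰r →
    let w , wc , dw = cycle-bounds bip ¬P₆ S (⊂-wellFounded S) k
          (λ M → k≰r (im≤ k (_ , Matching.isInducedMatching M))) zc
          (λ F → trans (sym (∂≐d z F)) (∂z F))
    in ¬bd (w , wc , λ F → trans (∂≐d w F) (dw F))
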